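{- Let $G$ be an FD-admissible graph of order $n$ and let $k = 1+\lfloor \log_2 n \rfloor \ge 5$. Then $\gamma^{\mathrm{FD}}(G) = k$ if and only if $G$ is obtained (up to isomorphism) from some graph $G^F(k) = (C \cup (V \setminus C), E)$ by removing up to $2^{k-1}-k$ vertices of $V \setminus C$ if $G^F(k)[C]$ has an isolated vertex, and up to $2^{k-1}-1-k$ vertices of $V \setminus C$ otherwise.
   Context: Graphs are finite, simple and undirected. For a graph $G=(V,E)$ and $v\in V$, $N(v)$ is the open neighborhood and $N[v]=N(v)\cup\{v\}$ the closed neighborhood; $G[C]$ is the subgraph induced by $C$. Open twins are distinct non-adjacent vertices $u,v$ with $N(u)=N(v)$; closed twins are distinct adjacent vertices $u,v$ with $N[u]=N[v]$. A set $C\subseteq V$ is dominating if $N[v]\cap C\neq\emptyset$ for all $v\in V$, and full-separating if $N(u)\cap C\neq N(v)\cap C$ and $N[u]\cap C\neq N[v]\cap C$ for all distinct $u,v\in V$. An FD-code is a set that is both full-separating and dominating. A graph is FD-admissible if it has an FD-code; $\gamma^{\mathrm{FD}}(G)$ is the minimum cardinality of an FD-code of $G$. For $k\ge 4$, $G^F(k)$ denotes any graph with vertex set $V$ and a subset $C\subseteq V$ such that $|C|=k$, the induced subgraph $G^F(k)[C]$ has neither open nor closed twins, and $V\setminus C$ consists of exactly one vertex $v_{C'}$ with $N(v_{C'})\cap C=C'$ for each non-empty subset $C'\subseteq C$ such that there is no vertex $u\in C$ with either $N(u)\cap C=C'$ or $N[u]\cap C=C'$; there is no condition on the edges inside $V\setminus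 C$. -}

module Defs where

open import Data.Bool.Properties using () renaming (_≟_ to _≟ᵇ_)
open import Data.Fin using (Fin; zero; suc; _≟_)
open import Data.Fin.Properties using (all?)
open import Data.Fin.Subset
  using (Subset; inside; outside; _∈_; _∉_; _⊆_; _∩_; _∪_; ∁; ⁅_⁆; ∣_∣; Nonempty; Empty)
open import Data.Fin.Subset.Properties using (nonempty?; anySubset?)
open import Data.Nat using (ℕ; _≤_; _<_; _<?_)
open import Data.Nat.Induction using (Acc; acc; <-wellFounded)
open import Data.Nat.Properties using (≮⇒≥)
open import Data.Product using (Σ; ∃; ∃-syntax; ∃!; _×_; _,_; proj₁)
open import Data.Sum using (_⊎_)
open import Data.Vec using ([]; _∷_; tabulate)
open import Data.Vec.Properties using (≡-dec)
open import Function.Bundles using (_⇔_; _↔_; module Inverse)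
open import Level using (0ℓ)
open import Relation.Binary.Core using (Rel)
open import Relation.Binary.Definitions using (Decidable; Irreflexive; Symmetric)
open import Relation.Binary.PropositionalEquality using (_≡_; _≢_; refl; cong)
open import Relation.Nullary using (¬_; Dec; does; yes; no)
open import Relation.Nullary.Decidable using (¬?; _×-dec_; _→-dec_)

private
  variable
    m n : ℕ

record Graph (n : ℕ) : Set₁ where
  infix 4 _~_ _~?_
  field
    _~_      : Rel (Fin n) 0ℓ
    _~?_     : Decidable _~_
    ~-sym    : Symmetric _~_
    ~-irrefl : Irreflexive _≡_ _~_

  N : Fin n → Subset n
  N v = tabulate λ u → does (v ~? u)

  N[_] : Fin n → Subset n
  N[ v ] = ⁅ v ⁆ ∪ N v

  OpenTwins : Fin n → Fin n → Set
  OpenTwins u v = u ≢ v × ¬ (u ~ v) × N u ≡ N v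

  ClosedTwins : Fin n → Fin n → Set
  ClosedTwins u v = u ≢ v × u ~ v × N[ u ] ≡ N[ v ]

  Isolated : Fin n → Set
  Isolated v = Empty (N v)

  Dominating : Subset n → Set
  Dominating C = ∀ v → Nonempty (N[ v ] ∩ C)

  FullSeparating : Subset n → Set
  FullSeparating C = ∀ u v → u ≢ v → N u ∩ C ≢ N v ∩ C × N[ u ] ∩ C ≢ N[ v ] ∩ C

  IsFDCode : Subset n → Set
  IsFDCode C = FullSeparating C × Dominating C

  FDAdmissible : Set
  FDAdmissible = ∃ IsFDCode

  isFDCode? : (C : Subset n) → Dec (IsFDCode C)
  isFDCode? C =
    (all? λ u → all? λ v → ¬? (u ≟ v) →-dec
      (¬? (≡-dec _≟ᵇ_ (N u ∩ C) (N v ∩ C)) ×-dec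
       ¬? (≡-dec _≟ᵇ_ (N[ u ] ∩ C) (N[ v ] ∩ C))))
    ×-dec (all? λ v → nonempty? (N[ v ] ∩ C))

  IsMinFDCardinality : ℕ → Set
  IsMinFDCardinality k =
    (∃[ C ] IsFDCode C × ∣ C ∣ ≡ k) × (∀ C → IsFDCode C → k ≤ ∣ C ∣)

  minFDCardinality : FDAdmissible → ∃ IsMinFDCardinality
  minFDCardinality (C , isCode) = descend C isCode (<-wellFounded ∣ C ∣)
    where
    descend : ∀ C → IsFDCode C → Acc _<_ ∣ C ∣ → ∃ IsMinFDCardinality
    descend C isCode (acc rec)
      with anySubset? (λ D → isFDCode? D ×-dec (∣ D ∣ <? ∣ C ∣))
    ... | yes (D , isCodeD , D<C) = descend D isCodeD (rec D<C)
    ... | no  ∄smaller =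
      ∣ C ∣ , (C , isCode , refl) , λ D isCodeD → ≮⇒≥ λ D<C → ∄smaller (D , isCodeD , D<C)

  γFD : FDAdmissible → ℕ
  γFD adm = proj₁ (minFDCardinality adm)

-- The increasing enumeration of the elements of a subset.
element : (C : Subset n) → Fin ∣ C ∣ → Fin n
element (inside  ∷ C) zero    = zero
element (inside  ∷ C) (suc i) = suc (element C i)
element (outside ∷ C) i       = suc (element C i)

-- The induced subgraph, its vertices renumbered along `element C`.
_[_] : Graph n → (C : Subset n) → Graph ∣ C ∣
G [ C ] = record
  { _~_      = λ i j → element C i ~ element C j
  ; _~?_     = λ i j → element C i ~? element C j
  ; ~-sym    = ~-sym
  ; ~-irrefl = λ i≡j → ~-irrefl (cong (element C) i≡j)
  }
  where open Graph G

infixl 5 _─ᵛ_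
_─ᵛ_ : Graph n → (R : Subset n) → Graph ∣ ∁ R ∣
G ─ᵛ R = G [ ∁ R ]

infix 4 _≅_
_≅_ : Graph m → Graph n → Set
_≅_ {m} {n} G H =
  Σ (Fin m ↔ Fin n) λ f → ∀ u v → u G.~ v ⇔ Inverse.to f u H.~ Inverse.to f v
  where
  module G = Graph G
  module H = Graph H

HasIsolatedVertex : Graph n → Set
HasIsolatedVertex G = ∃ (Graph.Isolated G)

module _ (G : Graph n) (C : Subset n) where
  open Graph G

  -- The sets C′ for which G^F(k) has a vertex v_C′ outside C.
  Unrealised : Subset n → Set
  Unrealised C′ =
    Nonempty C′ × C′ ⊆ C × ¬ (∃[ u ] u ∈ C × (N u ∩ C ≡ C′ ⊎ N[ u ] ∩ C ≡ C′))

  record IsGF (k : ℕ) : Set where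
    field
      4≤k           : 4 ≤ k
      ∣C∣≡k         : ∣ C ∣ ≡ k
      noOpenTwins   : ∀ i j → ¬ Graph.OpenTwins (G [ C ]) i j
      noClosedTwins : ∀ i j → ¬ Graph.ClosedTwins (G [ C ]) i j
      -- Together: v ↦ N v ∩ C is a bijection from V ∖ C to the unrealised sets.
      outer         : ∀ v → v ∉ C → Unrealised (N v ∩ C)
      uniqueOuter   : ∀ C′ → Unrealised C′ → ∃! _≡_ λ v → v ∉ C × N v ∩ C ≡ C′

{-# OPTIONS --safe #-}
module Submission where

-- For a code C, the traces N(v) ∩ C (v ∈ V) together with N[c] ∩ C (c ∈ C) are pairwise
-- distinct, and ∅ occurs among them only as the trace of an isolated vertex of G[C].  Attaching
-- one new vertex for each non-empty subset of C that is not of the form N(v) ∩ C or N[v] ∩ C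
-- turns G into a G^F(k).  Counting traces there gives n + |R| + k ≤ 2^k for the set R of new
-- vertices, strictly if G[C] has no isolated vertex, and 2^(k−1) ≤ n yields the bounds on |R|.
-- Conversely C is a code of G^F(k) and stays one in every induced subgraph containing C; no
-- smaller code exists because the n sets N[v] ∩ C are distinct and non-empty, so n < 2^|C|.

open import Defs
open import Data.Bool using (Bool)
open import Data.Bool.Properties using () renaming (_≟_ to _≟ᵇ_)
open import Data.Empty using () renaming (⊥ to Void)
open import Data.Fin using (Fin; zero; suc; _≟_; splitAt; _↑ˡ_; _↑ʳ_)
open import Data.Fin.Properties
  using (all?; any?; injective⇒≤; *↔×; 2↔Bool; +↔⊎; splitAt-↑ˡ; splitAt-↑ʳ; splitAt⁻¹-↑ˡ;
         splitAt⁻¹-↑ʳ; ↑ˡ-injective; suc-injective)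
open import Data.Fin.Subset
  using (Subset; inside; outside; _∈_; _∉_; _⊆_; _∩_; ∁; ⁅_⁆; ∣_∣; Nonempty; ⊥; ⊤)
open import Data.Fin.Subset.Properties
open import Data.Nat
  using (ℕ; zero; suc; _+_; _*_; _∸_; _^_; _≤_; _≥_; _<_; s≤s; z≤n; ⌊_/2⌋; ⌈_/2⌉)
open import Data.Nat.Induction using (<-rec)
open import Data.Nat.Logarithm using (⌊log₂_⌋; ⌊log₂⌊n/2⌋⌋≡⌊log₂n⌋∸1)
open import Data.Nat.Properties hiding (_≟_; suc-injective)
open import Data.Product using (Σ; ∃-syntax; _×_; _,_; proj₁; proj₂)
open import Data.Product.Function.NonDependent.Propositional using (_×-↔_)
open import Data.Sum using (_⊎_; inj₁; inj₂)
open import Data.Vec using ([]; _∷_; here; there; lookup; tabulate; uncons; _++_)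
open import Data.Vec.Properties
  using (≡-dec; []=⇒lookup; lookup⇒[]=; lookup∘tabulate; lookup-++ˡ; lookup-++ʳ)
open import Function using (_∘_; Injective)
open import Function.Bundles
  using (_⇔_; _↔_; mk↔ₛ′; mk⇔; module Equivalence; module Inverse; module Injection)
open import Function.Construct.Composition using (_↔-∘_)
open import Function.Construct.Symmetry using (↔-sym)
open import Function.Properties.Inverse using (↔⇒↣)
open import Relation.Binary.PropositionalEquality
  using (_≡_; _≢_; refl; sym; trans; cong; cong₂; subst; module ≡-Reasoning)
open import Relation.Nullary using (¬_; Dec; does; yes; no; contradiction)
open import Relation.Nullary.Decidable using (¬?; _×-dec_; dec-true; decidable-stable)

private
  variable
    l m n r : ℕ

-- Subsets, preimages and the enumeration of a subset

_≟ˢ_ : (p q : Subset n) → Dec (p ≡ q)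
_≟ˢ_ = ≡-dec _≟ᵇ_

does⇒ : {A : Set} (a? : Dec A) → does a? ≡ inside → A
does⇒ (yes a) _ = a

∈-tabulate⁺ : ∀ (f : Fin n → Bool) {x} → f x ≡ inside → x ∈ tabulate f
∈-tabulate⁺ f {x} eq = lookup⇒[]= x _ (trans (lookup∘tabulate f x) eq)

∈-tabulate⁻ : ∀ (f : Fin n → Bool) {x} → x ∈ tabulate f → f x ≡ inside
∈-tabulate⁻ f {x} x∈ = trans (sym (lookup∘tabulate f x)) ([]=⇒lookup x∈)

preimage : (Fin m → Fin n) → Subset n → Subset m
preimage f p = tabulate (lookup p ∘ f)

∈-preimage⁺ : ∀ (f : Fin m → Fin n) {p x} → f x ∈ p → x ∈ preimage f p
∈-preimage⁺ f fx∈p = ∈-tabulate⁺ _ ([]=⇒lookup fx∈p)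

∈-preimage⁻ : ∀ (f : Fin m → Fin n) {p x} → x ∈ preimage f p → f x ∈ p
∈-preimage⁻ f {p} {x} x∈ = lookup⇒[]= (f x) p (∈-tabulate⁻ (lookup p ∘ f) x∈)

_⊆Image_ : Subset n → (Fin m → Fin n) → Set
p ⊆Image f = ∀ {x} → x ∈ p → ∃[ i ] f i ≡ x

-- Every element of `C` has a preimage under `f`, so pulling back loses nothing inside `C`. This
-- carries separation and counting from a graph to an induced subgraph that contains the code.
preimage-∩-cancel : ∀ (f : Fin m → Fin n) {p q C} → C ⊆Image f →
  preimage f p ∩ preimage f C ≡ preimage f q ∩ preimage f C → p ∩ C ≡ q ∩ C
preimage-∩-cancel f {C = C} C⊆f eq = ⊆-antisym (half eq) (half (sym eq))
  where
  half : ∀ {p q} → preimage f p ∩ preimage f C ≡ preimage f q ∩ preimage f C → p ∩ C ⊆ q ∩ C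
  half {p} {q} eq x∈ with x∈p , x∈C ← x∈p∩q⁻ p C x∈ with i , refl ← C⊆f x∈C =
    x∈p∩q⁺ (∈-preimage⁻ f (p∩q⊆p _ _ (subst (i ∈_) eq
      (x∈p∩q⁺ (∈-preimage⁺ f x∈p , ∈-preimage⁺ f x∈C)))) , x∈C)

preimage-∩ : ∀ (f : Fin m → Fin n) p q → preimage f (p ∩ q) ≡ preimage f p ∩ preimage f q
preimage-∩ f p q = ⊆-antisym
  (λ x∈ → let a , b = x∈p∩q⁻ p q (∈-preimage⁻ f {p ∩ q} x∈) in
    x∈p∩q⁺ (∈-preimage⁺ f {p} a , ∈-preimage⁺ f {q} b))
  (λ x∈ → let a , b = x∈p∩q⁻ (preimage f p) _ x∈ in
    ∈-preimage⁺ f {p ∩ q} (x∈p∩q⁺ (∈-preimage⁻ f {p} a , ∈-preimage⁻ f {q} b)))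

⊆⇒∩≡ : ∀ {p q : Subset n} → p ⊆ q → p ∩ q ≡ p
⊆⇒∩≡ p⊆q = ⊆-antisym (p∩q⊆p _ _) λ x∈p → x∈p∩q⁺ (x∈p , p⊆q x∈p)

element-∈ : ∀ (C : Subset n) i → element C i ∈ C
element-∈ (inside  ∷ C) zero    = here
element-∈ (inside  ∷ C) (suc i) = there (element-∈ C i)
element-∈ (outside ∷ C) i       = there (element-∈ C i)

element-injective : ∀ (C : Subset n) → Injective _≡_ _≡_ (element C)
element-injective (inside  ∷ C) {zero}  {zero}  _  = refl
element-injective (inside  ∷ C) {suc i} {suc j} eq = cong suc (element-injective C (suc-injective eq))
element-injective (outside ∷ C) eq = element-injective C (suc-injective eq)

⊆Image-element : (C : Subset n) → C ⊆Image element C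
⊆Image-element (inside  ∷ C) here       = zero , refl
⊆Image-element (inside  ∷ C) (there x∈) = let i , eq = ⊆Image-element C x∈ in suc i , cong suc eq
⊆Image-element (outside ∷ C) (there x∈) = let i , eq = ⊆Image-element C x∈ in i , cong suc eq

injective-into⇒≤∣∣ : ∀ (C : Subset n) (f : Fin l → Fin n) →
  Injective _≡_ _≡_ f → (∀ i → f i ∈ C) → l ≤ ∣ C ∣
injective-into⇒≤∣∣ C f f-inj f∈C = injective⇒≤ {f = index} λ {i} {j} eq →
  f-inj (trans (sym (proj₂ (⊆Image-element C (f∈C i))))
    (trans (cong (element C) eq) (proj₂ (⊆Image-element C (f∈C j)))))
  where
  index : Fin _ → Fin ∣ C ∣
  index i = proj₁ (⊆Image-element C (f∈C i))

preimage-element : ∀ (C : Subset n) {p q} →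
  p ∩ C ≡ q ∩ C → preimage (element C) p ≡ preimage (element C) q
preimage-element C eq = ⊆-antisym (half eq) (half (sym eq))
  where
  half : ∀ {p q} → p ∩ C ≡ q ∩ C → preimage (element C) p ⊆ preimage (element C) q
  half eq {x} x∈ = ∈-preimage⁺ (element C) (p∩q⊆p _ _ (subst (element C x ∈_) eq
    (x∈p∩q⁺ (∈-preimage⁻ (element C) x∈ , element-∈ C x))))

∣preimage∣≤ : ∀ (f : Fin m → Fin n) → Injective _≡_ _≡_ f → ∀ C → ∣ preimage f C ∣ ≤ ∣ C ∣
∣preimage∣≤ f f-inj C = injective-into⇒≤∣∣ C (f ∘ element (preimage f C))
  (element-injective _ ∘ f-inj) (∈-preimage⁻ f ∘ element-∈ (preimage f C))

-- Counting families of subsets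

Subset↔Fin : ∀ n → Subset n ↔ Fin (2 ^ n)
Subset↔Fin zero    = mk↔ₛ′ (λ _ → zero) (λ _ → []) (λ { zero → refl }) (λ { [] → refl })
Subset↔Fin (suc n) = ↔-sym *↔× ↔-∘ ((↔-sym 2↔Bool ×-↔ Subset↔Fin n) ↔-∘
  mk↔ₛ′ uncons (λ (x , p) → x ∷ p) (λ _ → refl) (λ { (x ∷ p) → refl }))

-- Subsets of `C` are determined by their preimages under `element C`, and these range over a type
-- with `2 ^ ∣ C ∣` elements. All bounds on the order of a graph come from this.
injective-subsets⇒≤2^ : ∀ (C : Subset n) (f : Fin l → Subset n) →
  Injective _≡_ _≡_ f → (∀ i → f i ⊆ C) → l ≤ 2 ^ ∣ C ∣
injective-subsets⇒≤2^ C f f-inj f⊆C =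
  injective⇒≤ {f = Inverse.to (Subset↔Fin ∣ C ∣) ∘ preimage (element C) ∘ f} λ {i} {j} eq →
    f-inj (trans (sym (⊆⇒∩≡ (f⊆C i))) (trans
      (preimage-∩-cancel (element C) (⊆Image-element C)
        (cong (_∩ _) (Injection.injective (↔⇒↣ (Subset↔Fin ∣ C ∣)) eq)))
      (⊆⇒∩≡ (f⊆C j))))

-- The bijection with `Fin (2 ^ n)` turns the decidable family into a subset of `Fin (2 ^ n)`, which
-- `element` lists without repetition. The list supplies the vertices to be attached.
enumerate : {P : Subset n → Set} (P? : ∀ S → Dec (P S)) →
  ∃[ r ] Σ (Fin r → Subset n) λ f →
    Injective _≡_ _≡_ f × (∀ j → P (f j)) × (∀ S → P S → ∃[ j ] f j ≡ S)
enumerate {n} {P} P? = ∣ M ∣ , from ∘ element M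
  , element-injective M ∘ Injection.injective (↔⇒↣ (↔-sym (Subset↔Fin n)))
  , (λ j → does⇒ (P? _) (∈-tabulate⁻ _ (element-∈ M j)))
  , λ S PS → let j , eq = ⊆Image-element M (∈-tabulate⁺ _ (dec-true (P? (from (to S)))
                            (subst P (sym (strictlyInverseʳ S)) PS)))
             in j , trans (cong from eq) (strictlyInverseʳ S)
  where
  open Inverse (Subset↔Fin n)
  M : Subset (2 ^ n)
  M = tabulate λ i → does (P? (from i))

-- Concatenated subsets, and a power of two below `n`

∣++∣ : ∀ (p : Subset m) (q : Subset n) → ∣ p ++ q ∣ ≡ ∣ p ∣ + ∣ q ∣
∣++∣ []            q = refl
∣++∣ (inside  ∷ p) q = cong suc (∣++∣ p q)
∣++∣ (outside ∷ p) q = ∣++∣ p q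

∈-++ˡ : ∀ (p : Subset m) (q : Subset n) {x} → x ∈ p ⇔ x ↑ˡ n ∈ p ++ q
∈-++ˡ p q {x} = mk⇔
  (λ x∈ → lookup⇒[]= _ _ (trans (lookup-++ˡ p q x) ([]=⇒lookup x∈)))
  (λ x∈ → lookup⇒[]= _ _ (trans (sym (lookup-++ˡ p q x)) ([]=⇒lookup x∈)))

∈-++ʳ : ∀ (p : Subset m) (q : Subset n) {x} → x ∈ q ⇔ m ↑ʳ x ∈ p ++ q
∈-++ʳ p q {x} = mk⇔
  (λ x∈ → lookup⇒[]= _ _ (trans (lookup-++ʳ p q x) ([]=⇒lookup x∈)))
  (λ x∈ → lookup⇒[]= _ _ (trans (sym (lookup-++ʳ p q x)) ([]=⇒lookup x∈)))

-- Strong induction along halving, since passing from `n` to `⌊ n /2⌋` lowers the logarithm by one.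
2^⌊log₂⌋≤ : ∀ n → 1 ≤ n → 2 ^ ⌊log₂ n ⌋ ≤ n
2^⌊log₂⌋≤ = <-rec _ λ where
    (suc zero)      rec _ → ≤-refl
    n@(suc (suc i)) rec _ → begin
      -- The inequality `x ≤ 1 + (x ∸ 1)` holds for every `x`, so positivity of the logarithm need
      -- not be shown here.
      2 ^ ⌊log₂ n ⌋                ≤⟨ ^-monoʳ-≤ 2 (m≤n+m∸n ⌊log₂ n ⌋ 1) ⟩
      2 * 2 ^ (⌊log₂ n ⌋ ∸ 1)      ≡⟨ cong (λ j → 2 * 2 ^ j) (⌊log₂⌊n/2⌋⌋≡⌊log₂n⌋∸1 n) ⟨
      2 * 2 ^ ⌊log₂ ⌊ n /2⌋ ⌋      ≤⟨ *-monoʳ-≤ 2 (rec (⌊n/2⌋<n (suc i)) (s≤s z≤n)) ⟩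
      2 * ⌊ n /2⌋                  ≡⟨ cong (⌊ n /2⌋ +_) (+-identityʳ _) ⟩
      ⌊ n /2⌋ + ⌊ n /2⌋            ≤⟨ +-monoʳ-≤ ⌊ n /2⌋ (⌊n/2⌋≤⌈n/2⌉ n) ⟩
      ⌊ n /2⌋ + ⌈ n /2⌉            ≡⟨ ⌊n/2⌋+⌈n/2⌉≡n n ⟩
      n                            ∎
  where open ≤-Reasoning

-- Neighbourhoods and induced embeddings

module _ (G : Graph n) where
  open Graph G

  ∈N⁺ : ∀ {u v} → v ~ u → u ∈ N v
  ∈N⁺ {u} {v} v~u = ∈-tabulate⁺ _ (dec-true (v ~? u) v~u)

  ∈N⁻ : ∀ {u v} → u ∈ N v → v ~ u
  ∈N⁻ {u} {v} u∈ = does⇒ (v ~? u) (∈-tabulate⁻ (λ u → does (v ~? u)) u∈)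

  ∈N[]⁺ : ∀ {u v} → u ≡ v ⊎ v ~ u → u ∈ N[ v ]
  ∈N[]⁺ (inj₁ refl) = x∈p∪q⁺ (inj₁ (x∈⁅x⁆ _))
  ∈N[]⁺ (inj₂ v~u)  = x∈p∪q⁺ (inj₂ (∈N⁺ v~u))

  ∈N[]⁻ : ∀ {u v} → u ∈ N[ v ] → u ≡ v ⊎ v ~ u
  ∈N[]⁻ {u} {v} u∈ with x∈p∪q⁻ ⁅ v ⁆ (N v) u∈
  ... | inj₁ u∈⁅v⁆ = inj₁ (x∈⁅y⁆⇒x≡y v u∈⁅v⁆)
  ... | inj₂ u∈Nv  = inj₂ (∈N⁻ u∈Nv)

  N[]∩≡N∩ : ∀ {C v} → v ∉ C → N[ v ] ∩ C ≡ N v ∩ C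
  N[]∩≡N∩ {C} {v} v∉C = ⊆-antisym ⊆N λ x∈ →
    let x∈N , x∈C = x∈p∩q⁻ (N v) C x∈ in x∈p∩q⁺ (x∈p∪q⁺ (inj₂ x∈N) , x∈C)
    where
    ⊆N : N[ v ] ∩ C ⊆ N v ∩ C
    ⊆N x∈ with x∈N , x∈C ← x∈p∩q⁻ N[ v ] C x∈ with ∈N[]⁻ x∈N
    ... | inj₁ refl = contradiction x∈C v∉C
    ... | inj₂ v~x  = x∈p∩q⁺ (∈N⁺ v~x , x∈C)

-- Adjacency is both preserved and reflected, so neighbourhoods pull back exactly. The notion covers
-- the inclusion of `G [ C ]`, the inclusion of `G` into `attach G S`, and an isomorphism onto a
-- graph with vertices removed.
record _↪_ (G : Graph m) (H : Graph n) : Set where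
  private
    module G = Graph G
    module H = Graph H
  field
    to        : Fin m → Fin n
    injective : Injective _≡_ _≡_ to
    ~⇔~       : ∀ u v → u G.~ v ⇔ to u H.~ to v

  preimage-N : ∀ u → preimage to (H.N (to u)) ≡ G.N u
  preimage-N u = ⊆-antisym
    (λ x∈ → ∈N⁺ G (Equivalence.from (~⇔~ u _) (∈N⁻ H (∈-preimage⁻ to x∈))))
    (λ x∈ → ∈-preimage⁺ to (∈N⁺ H (Equivalence.to (~⇔~ u _) (∈N⁻ G x∈))))

  preimage-N[] : ∀ u → preimage to H.N[ to u ] ≡ G.N[ u ]
  preimage-N[] u = ⊆-antisym forth back
    where
    forth : preimage to H.N[ to u ] ⊆ G.N[ u ]
    forth x∈ with ∈N[]⁻ H (∈-preimage⁻ to x∈)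
    ... | inj₁ eq = ∈N[]⁺ G (inj₁ (injective eq))
    ... | inj₂ u~x = ∈N[]⁺ G (inj₂ (Equivalence.from (~⇔~ u _) u~x))
    back : G.N[ u ] ⊆ preimage to H.N[ to u ]
    back x∈ with ∈N[]⁻ G x∈
    ... | inj₁ refl = ∈-preimage⁺ to (∈N[]⁺ H (inj₁ refl))
    ... | inj₂ u~x = ∈-preimage⁺ to (∈N[]⁺ H (inj₂ (Equivalence.to (~⇔~ u _) u~x)))

module _ {G : Graph m} {H : Graph n} (e : G ↪ H) where
  open _↪_ e
  private
    module G = Graph G
    module H = Graph H

  -- The embedding misses no code vertex, so traces that differ on `C` still differ after pulling
  -- back, and each dominating vertex has a preimage.
  pullback-code : ∀ {C} → C ⊆Image to → H.IsFDCode C → G.IsFDCode (preimage to C)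
  pullback-code {C} C⊆ (sep , dom) = sep′ , dom′
    where
    sep′ : G.FullSeparating (preimage to C)
    sep′ u v u≢v =
        (λ eq → proj₁ (sep (to u) (to v) (u≢v ∘ injective)) (preimage-∩-cancel to C⊆
          (trans (cong (_∩ _) (preimage-N u)) (trans eq (cong (_∩ _) (sym (preimage-N v)))))))
      , (λ eq → proj₂ (sep (to u) (to v) (u≢v ∘ injective)) (preimage-∩-cancel to C⊆
          (trans (cong (_∩ _) (preimage-N[] u)) (trans eq (cong (_∩ _) (sym (preimage-N[] v)))))))
    dom′ : G.Dominating (preimage to C)
    dom′ v with x , x∈ ← dom (to v) with x∈N , x∈C ← x∈p∩q⁻ H.N[ to v ] C x∈
           with i , refl ← C⊆ x∈C =
      i , x∈p∩q⁺ (subst (i ∈_) (preimage-N[] v) (∈-preimage⁺ to x∈N) , ∈-preimage⁺ to x∈C)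

induced : (G : Graph n) (C : Subset n) → (G [ C ]) ↪ G
induced G C = record
  { to = element C ; injective = element-injective C ; ~⇔~ = λ _ _ → mk⇔ (λ a → a) (λ a → a) }

-- Codes, twins and traces

module _ (G : Graph n) (C : Subset n) where
  open Graph G
  private
    module G[C] = Graph (G [ C ])
  open _↪_ (induced G C) using (preimage-N; preimage-N[])

  -- With the three lemmas that follow, this translates between neighbourhoods in `G [ C ]`, where
  -- twins are defined, and traces in `G`, where codes are defined.
  N-induced⇒ : ∀ {i j} → G[C].N i ≡ G[C].N j → N (element C i) ∩ C ≡ N (element C j) ∩ C
  N-induced⇒ {i} {j} eq = preimage-∩-cancel (element C) (⊆Image-element C)
    (cong (_∩ _) (trans (preimage-N i) (trans eq (sym (preimage-N j)))))

  N[]-induced⇒ : ∀ {i j} →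
    G[C].N[ i ] ≡ G[C].N[ j ] → N[ element C i ] ∩ C ≡ N[ element C j ] ∩ C
  N[]-induced⇒ {i} {j} eq = preimage-∩-cancel (element C) (⊆Image-element C)
    (cong (_∩ _) (trans (preimage-N[] i) (trans eq (sym (preimage-N[] j)))))

  N-induced⇐ : ∀ {i j} → N (element C i) ∩ C ≡ N (element C j) ∩ C → G[C].N i ≡ G[C].N j
  N-induced⇐ {i} {j} eq =
    trans (sym (preimage-N i)) (trans (preimage-element C eq) (preimage-N j))

  N[]-induced⇐ : ∀ {i j} →
    N[ element C i ] ∩ C ≡ N[ element C j ] ∩ C → G[C].N[ i ] ≡ G[C].N[ j ]
  N[]-induced⇐ {i} {j} eq =
    trans (sym (preimage-N[] i)) (trans (preimage-element C eq) (preimage-N[] j))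

  -- Two vertices outside `C` are separated by `uniqueOuter`. A vertex outside `C` and one inside
  -- are separated because the outer trace is unrealised. Two vertices of `C` with equal traces
  -- would be twins in `G [ C ]`.
  IsGF⇒IsFDCode : ∀ {k} → IsGF G C k → IsFDCode C
  IsGF⇒IsFDCode gf =
    (λ u v u≢v →
        openSep u v u≢v (u ∈? C) (v ∈? C) , closedSep u v u≢v (u ∈? C) (v ∈? C)) , dom
    where
    open IsGF gf
    outerUnique : ∀ u v → u ∉ C → v ∉ C → N u ∩ C ≡ N v ∩ C → u ≡ v
    outerUnique u v u∉C v∉C eq with _ , _ , unique ← uniqueOuter _ (outer u u∉C) =
      trans (sym (unique (u∉C , refl))) (unique (v∉C , sym eq))
    openSep : ∀ u v → u ≢ v → Dec (u ∈ C) → Dec (v ∈ C) → N u ∩ C ≢ N v ∩ C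
    openSep u v u≢v (no u∉C) (no v∉C) eq = u≢v (outerUnique u v u∉C v∉C eq)
    openSep u v u≢v (no u∉C) (yes v∈C) eq = proj₂ (proj₂ (outer u u∉C)) (v , v∈C , inj₁ (sym eq))
    openSep u v u≢v (yes u∈C) (no v∉C) eq = proj₂ (proj₂ (outer v v∉C)) (u , u∈C , inj₁ eq)
    openSep u v u≢v (yes u∈C) (yes v∈C) eq
      with i , refl ← ⊆Image-element C u∈C | j , refl ← ⊆Image-element C v∈C =
      noOpenTwins i j (u≢v ∘ cong (element C) , ≁ , N-induced⇐ eq)
      where
      -- If `u ~ v`, then `v` lies in the trace of `u`, hence in its own open neighbourhood.
      ≁ : ¬ u ~ v
      ≁ u~v = ~-irrefl refl (∈N⁻ G (p∩q⊆p _ _ (subst (v ∈_) eq (x∈p∩q⁺ (∈N⁺ G u~v , v∈C)))))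
    closedSep : ∀ u v → u ≢ v → Dec (u ∈ C) → Dec (v ∈ C) → N[ u ] ∩ C ≢ N[ v ] ∩ C
    closedSep u v u≢v (no u∉C) (no v∉C) eq = u≢v (outerUnique u v u∉C v∉C
      (trans (sym (N[]∩≡N∩ G u∉C)) (trans eq (N[]∩≡N∩ G v∉C))))
    closedSep u v u≢v (no u∉C) (yes v∈C) eq =
      proj₂ (proj₂ (outer u u∉C)) (v , v∈C , inj₂ (trans (sym eq) (N[]∩≡N∩ G u∉C)))
    closedSep u v u≢v (yes u∈C) (no v∉C) eq =
      proj₂ (proj₂ (outer v v∉C)) (u , u∈C , inj₂ (trans eq (N[]∩≡N∩ G v∉C)))
    closedSep u v u≢v (yes u∈C) (yes v∈C) eq
      with i , refl ← ⊆Image-element C u∈C | j , refl ← ⊆Image-element C v∈C =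
      noClosedTwins i j (u≢v ∘ cong (element C) , adjacent , N[]-induced⇐ eq)
      where
      -- `v` lies in its own closed trace, hence in that of `u`, and it differs from `u`.
      adjacent : u ~ v
      adjacent with ∈N[]⁻ G (p∩q⊆p _ _ (subst (v ∈_) (sym eq) (x∈p∩q⁺ (∈N[]⁺ G (inj₁ refl) , v∈C))))
      ... | inj₁ v≡u = contradiction (sym v≡u) u≢v
      ... | inj₂ u~v = u~v
    dom : Dominating C
    dom v with v ∈? C
    ... | yes v∈C = v , x∈p∩q⁺ (∈N[]⁺ G (inj₁ refl) , v∈C)
    ... | no  v∉C = subst Nonempty (sym (N[]∩≡N∩ G v∉C)) (proj₁ (outer v v∉C))

  module _ (code : IsFDCode C) where
    private
      sep = proj₁ code
      dom = proj₂ code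

    outerNonempty : ∀ v → v ∉ C → Nonempty (N v ∩ C)
    outerNonempty v v∉C = subst Nonempty (N[]∩≡N∩ G v∉C) (dom v)

    N≡⇒≡ : ∀ {u v} → N u ∩ C ≡ N v ∩ C → u ≡ v
    N≡⇒≡ {u} {v} eq = decidable-stable (u ≟ v) λ u≢v → proj₁ (sep u v u≢v) eq

    N[]≡⇒≡ : ∀ {u v} → N[ u ] ∩ C ≡ N[ v ] ∩ C → u ≡ v
    N[]≡⇒≡ {u} {v} eq = decidable-stable (u ≟ v) λ u≢v → proj₂ (sep u v u≢v) eq

    -- If `u ∉ C`, its open and closed traces agree, so closed separation would give `u ≡ v ∈ C`. If
    -- `u ∈ C`, then `v ∈ N[ v ]` gives `u ~ v`, and so `u` would lie in `N[ v ] ∩ C`, which equals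
    -- `N u ∩ C`: a loop.
    N≢N[] : ∀ {u v} → v ∈ C → N u ∩ C ≢ N[ v ] ∩ C
    N≢N[] {u} {v} v∈C eq with u ∈? C
    ... | no u∉C = u∉C (subst (_∈ C) (sym (N[]≡⇒≡ (trans (N[]∩≡N∩ G u∉C) eq))) v∈C)
    ... | yes u∈C = ~-irrefl refl (∈N⁻ G (p∩q⊆p _ _ (subst (u ∈_) (sym eq)
                      (x∈p∩q⁺ (∈N[]⁺ G (inj₂ (~-sym u~v)) , u∈C)))))
      where
      u~v : u ~ v
      u~v = ∈N⁻ G (p∩q⊆p _ _ (subst (v ∈_) (sym eq) (x∈p∩q⁺ (∈N[]⁺ G (inj₁ refl) , v∈C))))

    -- A code already excludes twins and makes outer traces unrealised and distinct. Only the
    -- existence of a vertex for each unrealised set has to be supplied, as `complete`.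
    IsFDCode⇒IsGF : ∀ {k} → 4 ≤ k → ∣ C ∣ ≡ k →
      (∀ C′ → Unrealised G C C′ → ∃[ v ] v ∉ C × N v ∩ C ≡ C′) → IsGF G C k
    IsFDCode⇒IsGF 4≤k ∣C∣≡k complete = record
      { 4≤k = 4≤k
      ; ∣C∣≡k = ∣C∣≡k
      ; noOpenTwins = λ i j (i≢j , _ , eq) → i≢j (element-injective C (N≡⇒≡ (N-induced⇒ eq)))
      ; noClosedTwins = λ i j (i≢j , _ , eq) → i≢j (element-injective C (N[]≡⇒≡ (N[]-induced⇒ eq)))
      ; outer = λ v v∉C → outerNonempty v v∉C , p∩q⊆q _ _ , λ where
          (u , u∈C , inj₁ eq) → v∉C (subst (_∈ C) (N≡⇒≡ eq) u∈C)
          (u , u∈C , inj₂ eq) → N≢N[] u∈C (sym eq)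
      ; uniqueOuter = λ C′ unrealised → let v , v∉C , eq = complete C′ unrealised in
          v , (v∉C , eq) , λ (_ , eq′) → N≡⇒≡ (trans eq (sym eq′))
      }

    -- Domination keeps the closed traces away from the empty set, so the empty set can be added as
    -- one more value.
    order<2^ : n < 2 ^ ∣ C ∣
    order<2^ = injective-subsets⇒≤2^ C f f-injective f⊆C
      where
      f : Fin (suc n) → Subset n
      f zero    = ⊥
      f (suc v) = N[ v ] ∩ C
      ⊥≢ : ∀ {v} → ⊥ ≢ N[ v ] ∩ C
      ⊥≢ {v} eq = let x , x∈ = dom v in ∉⊥ (subst (x ∈_) (sym eq) x∈)
      f-injective : Injective _≡_ _≡_ f
      f-injective {zero}  {zero}  _  = refl
      f-injective {zero}  {suc v} eq = contradiction eq ⊥≢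
      f-injective {suc u} {zero}  eq = contradiction (sym eq) ⊥≢
      f-injective {suc u} {suc v} eq = cong suc (N[]≡⇒≡ eq)
      f⊆C : ∀ i → f i ⊆ C
      f⊆C zero    = ⊥⊆
      f⊆C (suc v) = p∩q⊆q _ _

    private
      trace⊎ : Fin n ⊎ Fin ∣ C ∣ → Subset n
      trace⊎ (inj₁ v) = N v ∩ C
      trace⊎ (inj₂ i) = N[ element C i ] ∩ C

      trace⊎-injective : Injective _≡_ _≡_ trace⊎
      trace⊎-injective {inj₁ u} {inj₁ v} eq = cong inj₁ (N≡⇒≡ eq)
      trace⊎-injective {inj₁ u} {inj₂ i} eq = contradiction eq (N≢N[] (element-∈ C i))
      trace⊎-injective {inj₂ i} {inj₁ u} eq = contradiction (sym eq) (N≢N[] (element-∈ C i))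
      trace⊎-injective {inj₂ i} {inj₂ j} eq = cong inj₂ (element-injective C (N[]≡⇒≡ eq))

      trace⊎⊆C : ∀ x → trace⊎ x ⊆ C
      trace⊎⊆C (inj₁ _) = p∩q⊆q _ _
      trace⊎⊆C (inj₂ _) = p∩q⊆q _ _

      trace : Fin (n + ∣ C ∣) → Subset n
      trace = trace⊎ ∘ splitAt n

      trace-injective : Injective _≡_ _≡_ trace
      trace-injective = Injection.injective (↔⇒↣ (+↔⊎ {n} {∣ C ∣})) ∘ trace⊎-injective

    order+∣C∣≤2^ : n + ∣ C ∣ ≤ 2 ^ ∣ C ∣
    order+∣C∣≤2^ = injective-subsets⇒≤2^ C trace trace-injective (trace⊎⊆C ∘ splitAt n)

    -- Again the empty set is a further value. A closed trace of a code vertex contains that vertex,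
    -- an outer trace is non-empty by domination, and an empty open trace of a code vertex would
    -- make it isolated in `G [ C ]`.
    order+∣C∣<2^ : ¬ HasIsolatedVertex (G [ C ]) → n + ∣ C ∣ < 2 ^ ∣ C ∣
    order+∣C∣<2^ ¬isolated = injective-subsets⇒≤2^ C f f-injective f⊆C
      where
      ⊥≢ : ∀ x → ⊥ ≢ trace⊎ x
      ⊥≢ (inj₂ i) eq = ∉⊥ (subst (element C i ∈_) (sym eq)
        (x∈p∩q⁺ (∈N[]⁺ G (inj₁ refl) , element-∈ C i)))
      ⊥≢ (inj₁ v) eq with v ∈? C
      ... | no v∉C = let x , x∈ = outerNonempty v v∉C in ∉⊥ (subst (x ∈_) (sym eq) x∈)
      ... | yes v∈C with i , refl ← ⊆Image-element C v∈C = ¬isolated (i , λ (j , j∈) →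
        ∉⊥ (subst (element C j ∈_) (sym eq)
          (x∈p∩q⁺ (∈N⁺ G (∈N⁻ (G [ C ]) j∈) , element-∈ C j))))
      f : Fin (suc (n + ∣ C ∣)) → Subset n
      f zero    = ⊥
      f (suc i) = trace i
      f-injective : Injective _≡_ _≡_ f
      f-injective {zero}  {zero}  _  = refl
      f-injective {zero}  {suc j} eq = contradiction eq (⊥≢ (splitAt n j))
      f-injective {suc i} {zero}  eq = contradiction (sym eq) (⊥≢ (splitAt n i))
      f-injective {suc i} {suc j} eq = cong suc (trace-injective eq)
      f⊆C : ∀ i → f i ⊆ C
      f⊆C zero    = ⊥⊆
      f⊆C (suc i) = trace⊎⊆C (splitAt n i)

-- Attaching new vertices

splitView : ∀ n (x : Fin (n + r)) → (∃[ u ] u ↑ˡ r ≡ x) ⊎ (∃[ j ] n ↑ʳ j ≡ x)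
splitView n x with splitAt n x in eq
... | inj₁ u = inj₁ (u , splitAt⁻¹-↑ˡ eq)
... | inj₂ j = inj₂ (j , splitAt⁻¹-↑ʳ eq)

↑ˡ≢↑ʳ : ∀ {u : Fin n} {j : Fin r} → u ↑ˡ r ≢ n ↑ʳ j
↑ˡ≢↑ʳ {n} {r} {u} {j} eq
  with () ← trans (sym (splitAt-↑ˡ n u r)) (trans (cong (splitAt n) eq) (splitAt-↑ʳ n r j))

-- The new vertices form an independent set; a `G^F(k)` leaves the edges outside `C` free, and this
-- is the simplest choice.
attach : Graph n → (Fin r → Subset n) → Graph (n + r)
attach {n} {r} G S = record
  { _~_      = λ x y → Adj (splitAt n x) (splitAt n y)
  ; _~?_     = λ x y → Adj? (splitAt n x) (splitAt n y)
  ; ~-sym    = λ {x} {y} → Adj-sym (splitAt n x) (splitAt n y)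
  ; ~-irrefl = λ { {x} refl → Adj-irrefl (splitAt n x) }
  }
  where
  open Graph G
  Adj : Fin n ⊎ Fin r → Fin n ⊎ Fin r → Set
  Adj (inj₁ u) (inj₁ v) = u ~ v
  Adj (inj₁ u) (inj₂ j) = u ∈ S j
  Adj (inj₂ j) (inj₁ u) = u ∈ S j
  Adj (inj₂ _) (inj₂ _) = Void
  Adj? : ∀ x y → Dec (Adj x y)
  Adj? (inj₁ u) (inj₁ v) = u ~? v
  Adj? (inj₁ u) (inj₂ j) = u ∈? S j
  Adj? (inj₂ j) (inj₁ u) = u ∈? S j
  Adj? (inj₂ _) (inj₂ _) = no λ ()
  Adj-sym : ∀ x y → Adj x y → Adj y x
  Adj-sym (inj₁ u) (inj₁ v) = ~-sym
  Adj-sym (inj₁ u) (inj₂ j) u∈ = u∈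
  Adj-sym (inj₂ j) (inj₁ u) u∈ = u∈
  Adj-irrefl : ∀ x → ¬ Adj x x
  Adj-irrefl (inj₁ u) = ~-irrefl refl

module _ (G : Graph n) (S : Fin r → Subset n) where
  private
    module G = Graph G
    module H = Graph (attach G S)

  attach-↪ : G ↪ attach G S
  attach-↪ = record
    { to        = _↑ˡ r
    ; injective = ↑ˡ-injective r _ _
    ; ~⇔~       = adjacency
    }
    where
    adjacency : ∀ u v → u G.~ v ⇔ (u ↑ˡ r) H.~ (v ↑ˡ r)
    adjacency u v rewrite splitAt-↑ˡ n u r | splitAt-↑ˡ n v r = mk⇔ (λ a → a) (λ a → a)

  ~-attached : ∀ j u → u ∈ S j ⇔ (n ↑ʳ j) H.~ (u ↑ˡ r)
  ~-attached j u rewrite splitAt-↑ˡ n u r | splitAt-↑ʳ n r j = mk⇔ (λ a → a) (λ a → a)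

  preimage-N-attached : ∀ j → preimage (_↑ˡ r) (H.N (n ↑ʳ j)) ≡ S j
  preimage-N-attached j = ⊆-antisym
    (λ {u} u∈ → Equivalence.from (~-attached j u) (∈N⁻ (attach G S) (∈-preimage⁻ (_↑ˡ r) u∈)))
    (λ {u} u∈ → ∈-preimage⁺ (_↑ˡ r) (∈N⁺ (attach G S) (Equivalence.to (~-attached j u) u∈)))

  preimage-N[]-attached : ∀ j → preimage (_↑ˡ r) H.N[ n ↑ʳ j ] ≡ S j
  preimage-N[]-attached j = ⊆-antisym forth
    λ {u} u∈ → ∈-preimage⁺ (_↑ˡ r)
      (∈N[]⁺ (attach G S) (inj₂ (Equivalence.to (~-attached j u) u∈)))
    where
    forth : preimage (_↑ˡ r) H.N[ n ↑ʳ j ] ⊆ S j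
    forth {u} u∈ with ∈N[]⁻ (attach G S) (∈-preimage⁻ (_↑ˡ r) u∈)
    ... | inj₁ eq  = contradiction eq ↑ˡ≢↑ʳ
    ... | inj₂ j~u = Equivalence.from (~-attached j u) j~u

  -- The old vertices are listed both by `_↑ˡ r` and by the enumeration of the complement of the new
  -- block; the bijection matches the two lists.
  attach─≅ : G ≅ (attach G S ─ᵛ (⊥ {n} ++ ⊤ {r}))
  attach─≅ = mk↔ₛ′ to from to∘from from∘to , adjacency
    where
    K : Subset (n + r)
    K = ∁ (⊥ {n} ++ ⊤ {r})
    ↑ˡ∈K : ∀ u → u ↑ˡ r ∈ K
    ↑ˡ∈K u = x∉p⇒x∈∁p λ u∈ → ∉⊥ (Equivalence.from (∈-++ˡ ⊥ ⊤) u∈)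
    K⊆Image↑ˡ : K ⊆Image (_↑ˡ r)
    K⊆Image↑ˡ {x} x∈ with splitView n x
    ... | inj₁ u,eq = u,eq
    ... | inj₂ (j , refl) = contradiction (Equivalence.to (∈-++ʳ (⊥ {n}) ⊤) ∈⊤) (x∈∁p⇒x∉p x∈)
    to : Fin n → Fin ∣ K ∣
    to u = proj₁ (⊆Image-element K (↑ˡ∈K u))
    from : Fin ∣ K ∣ → Fin n
    from i = proj₁ (K⊆Image↑ˡ (element-∈ K i))
    element-to : ∀ u → element K (to u) ≡ u ↑ˡ r
    element-to u = proj₂ (⊆Image-element K (↑ˡ∈K u))
    ↑ˡ-from : ∀ i → from i ↑ˡ r ≡ element K i
    ↑ˡ-from i = proj₂ (K⊆Image↑ˡ (element-∈ K i))
    to∘from : ∀ i → to (from i) ≡ i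
    to∘from i = element-injective K (trans (element-to (from i)) (↑ˡ-from i))
    from∘to : ∀ u → from (to u) ≡ u
    from∘to u = ↑ˡ-injective r _ _ (trans (↑ˡ-from (to u)) (element-to u))
    adjacency : ∀ u v → u G.~ v ⇔ element K (to u) H.~ element K (to v)
    adjacency u v rewrite element-to u | element-to v = _↪_.~⇔~ attach-↪ u v

-- Completing a graph with a code to a `G^F(k)`

module _ (G : Graph n) (C : Subset n) (code : Graph.IsFDCode G C) where
  open Graph G

  -- Unlike in `Unrealised`, `u` ranges over all vertices: a set that is the trace of an old vertex
  -- outside `C` must not receive a second vertex.
  Missing : Subset n → Set
  Missing T = Nonempty T × T ⊆ C × (∀ u → N u ∩ C ≢ T × N[ u ] ∩ C ≢ T)

  missing? : ∀ T → Dec (Missing T)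
  missing? T = nonempty? T ×-dec T ⊆? C ×-dec
    all? λ u → ¬? ((N u ∩ C) ≟ˢ T) ×-dec ¬? ((N[ u ] ∩ C) ≟ˢ T)

  module Completion {r} (S : Fin r → Subset n) (S-injective : Injective _≡_ _≡_ S)
    (S-missing : ∀ j → Missing (S j)) (S-complete : ∀ T → Missing T → ∃[ j ] S j ≡ T) where

    H : Graph (n + r)
    H = attach G S

    private
      module H = Graph H
      φ : Fin n → Fin (n + r)
      φ = _↑ˡ r
    open _↪_ (attach-↪ G S) using (preimage-N; preimage-N[])

    C⁺ : Subset (n + r)
    C⁺ = C ++ ⊥

    ∣C⁺∣≡∣C∣ : ∣ C⁺ ∣ ≡ ∣ C ∣
    ∣C⁺∣≡∣C∣ = trans (∣++∣ C (⊥ {r})) (trans (cong (∣ C ∣ +_) (∣⊥∣≡0 r)) (+-identityʳ _))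

    attached∉C⁺ : ∀ j → n ↑ʳ j ∉ C⁺
    attached∉C⁺ j j∈ = ∉⊥ (Equivalence.from (∈-++ʳ C ⊥) j∈)

    C⁺⊆Image : C⁺ ⊆Image φ
    C⁺⊆Image {x} x∈ with splitView n x
    ... | inj₁ u,eq = u,eq
    ... | inj₂ (j , refl) = contradiction x∈ (attached∉C⁺ j)

    preimage-C⁺ : preimage φ C⁺ ≡ C
    preimage-C⁺ = ⊆-antisym
      (λ x∈ → Equivalence.from (∈-++ˡ C ⊥) (∈-preimage⁻ φ {C⁺} x∈))
      (λ x∈ → ∈-preimage⁺ φ (Equivalence.to (∈-++ˡ C ⊥) x∈))

    -- `C⁺` lies in the image of `φ` and pulls back to `C`, so traces on `C⁺` can be compared inside
    -- `G`; `∩C⁺≡⇐` is the converse.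
    ∩C⁺≡⇒ : ∀ {p q} → p ∩ C⁺ ≡ q ∩ C⁺ → preimage φ p ∩ C ≡ preimage φ q ∩ C
    ∩C⁺≡⇒ {p} {q} eq = subst (λ D → preimage φ p ∩ D ≡ preimage φ q ∩ D) preimage-C⁺
      (trans (sym (preimage-∩ φ p C⁺)) (trans (cong (preimage φ) eq) (preimage-∩ φ q C⁺)))

    ∩C⁺≡⇐ : ∀ {p q} → preimage φ p ∩ C ≡ preimage φ q ∩ C → p ∩ C⁺ ≡ q ∩ C⁺
    ∩C⁺≡⇐ {p} {q} eq = preimage-∩-cancel φ C⁺⊆Image
      (subst (λ D → preimage φ p ∩ D ≡ preimage φ q ∩ D) (sym preimage-C⁺) eq)

    S∩C≡S : ∀ j → S j ∩ C ≡ S j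
    S∩C≡S j = ⊆⇒∩≡ (proj₁ (proj₂ (S-missing j)))

    -- The maps `X` and `X⁺` stand for open or for closed neighbourhoods. Both pull back to `S j` at
    -- a new vertex, so one argument serves both kinds of separation.
    separates : (X : Fin n → Subset n) (X⁺ : Fin (n + r) → Subset (n + r)) →
      (∀ u → preimage φ (X⁺ (u ↑ˡ r)) ≡ X u) → (∀ j → preimage φ (X⁺ (n ↑ʳ j)) ≡ S j) →
      (∀ u v → u ≢ v → X u ∩ C ≢ X v ∩ C) → (∀ u j → X u ∩ C ≢ S j) →
      ∀ x y → x ≢ y → X⁺ x ∩ C⁺ ≢ X⁺ y ∩ C⁺
    separates X X⁺ X⁺-old X⁺-new sep ≢S x y x≢y eq with splitView n x | splitView n y
    ... | inj₁ (u , refl) | inj₁ (v , refl) = sep u v (x≢y ∘ cong φ)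
      (trans (cong (_∩ C) (sym (X⁺-old u))) (trans (∩C⁺≡⇒ eq) (cong (_∩ C) (X⁺-old v))))
    ... | inj₁ (u , refl) | inj₂ (j , refl) = ≢S u j
      (trans (cong (_∩ C) (sym (X⁺-old u)))
        (trans (∩C⁺≡⇒ eq) (trans (cong (_∩ C) (X⁺-new j)) (S∩C≡S j))))
    ... | inj₂ (j , refl) | inj₁ (u , refl) = ≢S u j
      (trans (cong (_∩ C) (sym (X⁺-old u)))
        (trans (∩C⁺≡⇒ (sym eq)) (trans (cong (_∩ C) (X⁺-new j)) (S∩C≡S j))))
    ... | inj₂ (i , refl) | inj₂ (j , refl) = x≢y (cong (n ↑ʳ_) (S-injective (begin
      S i                          ≡⟨ S∩C≡S i ⟨
      S i ∩ C                      ≡⟨ cong (_∩ C) (X⁺-new i) ⟨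
      preimage φ (X⁺ x) ∩ C        ≡⟨ ∩C⁺≡⇒ eq ⟩
      preimage φ (X⁺ y) ∩ C        ≡⟨ cong (_∩ C) (X⁺-new j) ⟩
      S j ∩ C                      ≡⟨ S∩C≡S j ⟩
      S j                          ∎)))
      where open ≡-Reasoning

    C⁺-code : H.IsFDCode C⁺
    C⁺-code =
      (λ x y x≢y →
          separates N H.N preimage-N (preimage-N-attached G S)
            (λ u v u≢v → proj₁ (proj₁ code u v u≢v))
            (λ u j → proj₁ (proj₂ (proj₂ (S-missing j)) u)) x y x≢y
        , separates N[_] H.N[_] preimage-N[] (preimage-N[]-attached G S)
            (λ u v u≢v → proj₂ (proj₁ code u v u≢v))
            (λ u j → proj₂ (proj₂ (proj₂ (S-missing j)) u)) x y x≢y)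
      , dominating
      where
      dominated : ∀ x → Nonempty (preimage φ H.N[ x ] ∩ C) → Nonempty (H.N[ x ] ∩ C⁺)
      dominated x (y , y∈) with y∈N , y∈C ← x∈p∩q⁻ (preimage φ H.N[ x ]) C y∈ =
        φ y , x∈p∩q⁺ (∈-preimage⁻ φ y∈N , Equivalence.to (∈-++ˡ C ⊥) y∈C)
      dominating : H.Dominating C⁺
      dominating x with splitView n x
      ... | inj₁ (u , refl) = dominated x
        (subst (λ p → Nonempty (p ∩ C)) (sym (preimage-N[] u)) (proj₂ code u))
      ... | inj₂ (j , refl) = dominated x
        (subst (λ p → Nonempty (p ∩ C)) (sym (preimage-N[]-attached G S j))
          (subst Nonempty (sym (S∩C≡S j)) (proj₁ (S-missing j))))

    complete : ∀ C′ → Unrealised H C⁺ C′ → ∃[ x ] x ∉ C⁺ × H.N x ∩ C⁺ ≡ C′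
    complete C′ ((x , x∈) , C′⊆C⁺ , unrealised) =
      -- Either an old vertex outside `C` already has trace `T`, or no vertex at all has it; in the
      -- latter case `T` is missing and some attached vertex realises it.
      find (any? λ u → ¬? (u ∈? C) ×-dec ((N u ∩ C) ≟ˢ T))
      where
      T : Subset n
      T = preimage φ C′
      T⊆C : T ⊆ C
      T⊆C y∈ = Equivalence.from (∈-++ˡ C ⊥) (C′⊆C⁺ (∈-preimage⁻ φ y∈))
      lift≡ : ∀ {p} → preimage φ p ∩ C ≡ T → p ∩ C⁺ ≡ C′
      lift≡ eq = trans (∩C⁺≡⇐ (trans eq (sym (⊆⇒∩≡ T⊆C)))) (⊆⇒∩≡ C′⊆C⁺)
      N≡T : ∀ {u} → N u ∩ C ≡ T → H.N (φ u) ∩ C⁺ ≡ C′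
      N≡T {u} eq = lift≡ (trans (cong (_∩ C) (preimage-N u)) eq)
      N[]≡T : ∀ {u} → N[ u ] ∩ C ≡ T → H.N[ φ u ] ∩ C⁺ ≡ C′
      N[]≡T {u} eq = lift≡ (trans (cong (_∩ C) (preimage-N[] u)) eq)
      T-nonempty : Nonempty T
      T-nonempty with y , refl ← C⁺⊆Image (C′⊆C⁺ x∈) = y , ∈-preimage⁺ φ x∈
      find : Dec (∃[ u ] u ∉ C × N u ∩ C ≡ T) → ∃[ x ] x ∉ C⁺ × H.N x ∩ C⁺ ≡ C′
      find (yes (u , u∉C , eq)) = φ u , u∉C ∘ Equivalence.from (∈-++ˡ C ⊥) , N≡T eq
      find (no ∄outer) =
        let j , eq = S-complete T
              (T-nonempty , T⊆C , λ u → ≢N u (u ∈? C) , ≢N[] u (u ∈? C))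
        in n ↑ʳ j , attached∉C⁺ j
         , lift≡ (trans (cong (_∩ C) (preimage-N-attached G S j)) (trans (S∩C≡S j) eq))
        where
        ≢N : ∀ u → Dec (u ∈ C) → N u ∩ C ≢ T
        ≢N u (yes u∈C) eq = unrealised (φ u , Equivalence.to (∈-++ˡ C ⊥) u∈C , inj₁ (N≡T eq))
        ≢N u (no u∉C) eq = ∄outer (u , u∉C , eq)
        ≢N[] : ∀ u → Dec (u ∈ C) → N[ u ] ∩ C ≢ T
        ≢N[] u (yes u∈C) eq = unrealised (φ u , Equivalence.to (∈-++ˡ C ⊥) u∈C , inj₂ (N[]≡T eq))
        ≢N[] u (no u∉C) eq = ∄outer (u , u∉C , trans (sym (N[]∩≡N∩ G u∉C)) eq)

completion : ∀ (G : Graph n) C → Graph.IsFDCode G C →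
  ∃[ r ] Σ (Fin r → Subset n) λ S → let C⁺ = C ++ ⊥ {r} in
    ∣ C⁺ ∣ ≡ ∣ C ∣ × Graph.IsFDCode (attach G S) C⁺ ×
    (∀ C′ → Unrealised (attach G S) C⁺ C′ → ∃[ x ] x ∉ C⁺ × Graph.N (attach G S) x ∩ C⁺ ≡ C′)
completion G C code with r , S , S-inj , S-missing , S-complete ← enumerate (missing? G C code) =
  r , S , ∣C⁺∣≡∣C∣ , C⁺-code , complete
  where open Completion G C code S S-inj S-missing S-complete

-- The bound on removed vertices, and the equivalence

≅─⇒↪ : ∀ {G : Graph n} {H : Graph m} R → G ≅ (H ─ᵛ R) →
  Σ (G ↪ H) λ e → ∁ R ⊆Image _↪_.to e
≅─⇒↪ R (f , adjacency) =
  record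
    { to        = element (∁ R) ∘ Inverse.to f
    ; injective = Injection.injective (↔⇒↣ f) ∘ element-injective (∁ R)
    ; ~⇔~       = adjacency
    }
  , λ x∈ → let i , eq = ⊆Image-element (∁ R) x∈ in
      Inverse.from f i , trans (cong (element (∁ R)) (Inverse.strictlyInverseˡ f i)) eq

-- c = 1 when the empty set is not a trace, that is, G^F(k)[C] has no isolated vertex.
removed≤ : ∀ j {n r k} c → 2 ^ j ≤ n → c + (n + r + k) ≤ 2 ^ suc j → r ≤ 2 ^ j ∸ c ∸ k
removed≤ j {n} {r} {k} c 2^j≤n bound =
  m+n≤o⇒m≤o∸n r (m+n≤o⇒m≤o∸n (r + k) (+-cancelˡ-≤ (2 ^ j) _ _ (begin
    2 ^ j + (r + k + c)   ≤⟨ +-monoˡ-≤ (r + k + c) 2^j≤n ⟩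
    n + (r + k + c)       ≡⟨ +-assoc n (r + k) c ⟨
    n + (r + k) + c       ≡⟨ cong (_+ c) (+-assoc n r k) ⟨
    n + r + k + c         ≡⟨ +-comm (n + r + k) c ⟩
    c + (n + r + k)       ≤⟨ bound ⟩
    2 ^ suc j             ≡⟨ cong (2 ^ j +_) (+-identityʳ (2 ^ j)) ⟩
    2 ^ j + 2 ^ j         ∎)))
  where open ≤-Reasoning

log-positive⇒positive : ∀ n → 1 ≤ ⌊log₂ n ⌋ → 1 ≤ n
log-positive⇒positive (suc n) _ = s≤s z≤n

theorem9 : ∀ {n} (G : Graph n) (adm : Graph.FDAdmissible G) (k : ℕ) →
    k ≡ 1 + ⌊log₂ n ⌋ → k ≥ 5 →
    (Graph.γFD G adm ≡ k) ⇔
    (∃[ m ] Σ (Graph m) λ H → ∃[ C ] ∃[ R ]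
    IsGF H C k ×
    R ⊆ ∁ C ×
    (HasIsolatedVertex (H [ C ]) → ∣ R ∣ ≤ 2 ^ (k ∸ 1) ∸ k) ×
    (¬ HasIsolatedVertex (H [ C ]) → ∣ R ∣ ≤ 2 ^ (k ∸ 1) ∸ 1 ∸ k) ×
    (G ≅ (H ─ᵛ R)))
theorem9 {n} G adm k refl k≥5@(s≤s 4≤log) = mk⇔ forth back
  where
  2^log≤n : 2 ^ ⌊log₂ n ⌋ ≤ n
  2^log≤n = 2^⌊log₂⌋≤ n (log-positive⇒positive n (≤-trans (s≤s z≤n) 4≤log))

  forth : Graph.γFD G adm ≡ k → _
  forth γ≡k
    with (C , code , ∣C∣≡γ) , _ ← proj₂ (Graph.minFDCardinality G adm)
    with r , S , ∣C⁺∣≡∣C∣ , C⁺-code , complete ← completion G C code =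
    -- `H` is the completion of `G` along a minimum code, and `R` is the block of its `r` attached
    -- vertices.
    n + r , H , C⁺ , R
    , IsFDCode⇒IsGF H C⁺ C⁺-code (≤-trans (n≤1+n 4) k≥5) ∣C⁺∣≡k complete
    , (λ {x} → R⊆∁C⁺ {x})
    , (λ _ → subst (_≤ _) (sym ∣R∣≡r) (removed≤ ⌊log₂ n ⌋ 0 2^log≤n
        (subst (λ j → n + r + j ≤ 2 ^ j) ∣C⁺∣≡k (order+∣C∣≤2^ H C⁺ C⁺-code))))
    , (λ ¬isolated → subst (_≤ _) (sym ∣R∣≡r) (removed≤ ⌊log₂ n ⌋ 1 2^log≤n
        (subst (λ j → n + r + j < 2 ^ j) ∣C⁺∣≡k (order+∣C∣<2^ H C⁺ C⁺-code ¬isolated))))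
    , attach─≅ G S
    where
    H : Graph (n + r)
    H = attach G S
    C⁺ R : Subset (n + r)
    C⁺ = C ++ ⊥
    R = ⊥ {n} ++ ⊤
    ∣C⁺∣≡k : ∣ C⁺ ∣ ≡ k
    ∣C⁺∣≡k = trans ∣C⁺∣≡∣C∣ (trans ∣C∣≡γ γ≡k)
    ∣R∣≡r : ∣ R ∣ ≡ r
    ∣R∣≡r = trans (∣++∣ (⊥ {n}) (⊤ {r})) (cong₂ _+_ (∣⊥∣≡0 n) (∣⊤∣≡n r))
    R⊆∁C⁺ : R ⊆ ∁ C⁺
    R⊆∁C⁺ {x} x∈R with splitView n x
    ... | inj₁ (u , refl) = contradiction (Equivalence.from (∈-++ˡ ⊥ ⊤) x∈R) ∉⊥
    ... | inj₂ (j , refl) = x∉p⇒x∈∁p λ x∈C⁺ → ∉⊥ (Equivalence.from (∈-++ʳ C ⊥) x∈C⁺)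

  back : _ → Graph.γFD G adm ≡ k
  back (m , H , C , R , gf , R⊆∁C , _ , _ , G≅H─R)
    with (D , D-code , ∣D∣≡γ) , minimal ← proj₂ (Graph.minFDCardinality G adm)
    with e , ∁R⊆Image ← ≅─⇒↪ {G = G} {H} R G≅H─R = ≤-antisym γ≤k k≤γ
    where
    C⊆Image : C ⊆Image _↪_.to e
    C⊆Image x∈C = ∁R⊆Image (x∉p⇒x∈∁p λ x∈R → x∈∁p⇒x∉p (R⊆∁C x∈R) x∈C)
    γ≤k : Graph.γFD G adm ≤ k
    -- `R` avoids `C`, so `C` survives the removal and pulls back to a code of `G` with at most `k`
    -- vertices.
    γ≤k = ≤-trans (minimal _ (pullback-code e C⊆Image (IsGF⇒IsFDCode H C gf)))
      (≤-trans (∣preimage∣≤ (_↪_.to e) (_↪_.injective e) C) (≤-reflexive (IsGF.∣C∣≡k gf)))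
    k≤γ : k ≤ Graph.γFD G adm
    -- As `k` is one more than the logarithm, a smaller minimum code `D` would give
    -- `n < 2 ^ ∣ D ∣ ≤ 2 ^ ⌊log₂ n ⌋ ≤ n`.
    k≤γ = subst (k ≤_) ∣D∣≡γ (≰⇒> λ ∣D∣≤log → <-irrefl refl
      (≤-trans (order<2^ G D D-code) (≤-trans (^-monoʳ-≤ 2 ∣D∣≤log) 2^log≤n)))
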